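{- Let $L$ be a virtual link diagram with $e$ classical crossings, let $s$ be a state of $L$, let $G_L^s$ be the signed ribbon graph corresponding to $s$, and let $v:=v(G_L^s)$, $k:=k(G_L^s)$. Then $e=e(G_L^s)$ and the Kauffman bracket of $L$ satisfies $$[L](A,B,d) = A^e\left( x^k y^v z^{v+1} R_{G_L^s}(x,y,z)\Big|_{x=\frac{Ad}{B},\ y=\frac{Bd}{A},\ z=\frac{1}{d}}\right),$$ where $R$ is the signed Bollobás–Riordan polynomial.
   Context: **Ribbon graphs.** A ribbon graph $G$ is a (possibly non-orientable) surface with boundary, represented as the union of two finite sets of closed topological discs, vertices $V(G)$ and edges $E(G)$, such that: vertices and edges intersect in disjoint line segments; each such segment lies on the boundary of precisely one vertex and precisely one edge; every edge contains exactly two such segments. Ribbon graphs are considered up to homeomorphism preserving the decomposition. $G$ is signed if it comes with a sign function $\varepsilon:E(G)\to\{\pm1\}$. **Arrow presentation.** Equivalently, a ribbon graph is a collection of disjoint oriented circles (one per vertex) carrying labeled arrows, each label occurring exactly twice, modulo: reversing all arrows on a circle together with the cyclic order of arrows along it; reversing both arrows with the same label. To recover the surface, fill each circle with a vertex-disc and, for each label, attach a rectangle (the edge) along a pair of opposite sides to the two arrows with that label, so that both arrows are coherent with one orientation of the boundary of the rectangle. **Signed Bollobás–Riordan polynomial.** $v(G)=|V(G)|$, $e(G)=|E(G)|$, $k(G)$ is the number of connected components, $r(G)=v(G)-k(G)$, $n(G)=e(G)-r(G)$, $f(G)$ is the number of connected components of the boundary of the surface $G$. $\mathcal F(G)$ is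 the set of spanning subgraphs (all vertices, a subset of the edges). For $F\in\mathcal F(G)$, $\overline F$ is the spanning subgraph with the complementary edge set, $e_-(F)$ is the number of negative edges of $F$, $s(F)=\frac{e_-(F)-e_-(\overline F)}{2}$. Then $$R_G(x,y,z):=\sum_{F\in\mathcal F(G)} x^{r(G)-r(F)+s(F)}\,y^{n(F)-s(F)}\,z^{k(F)-f(F)+n(F)}.$$ If half-integer exponents occur, the substitution (which satisfies $xyz^2=1$) is understood with $x^{1/2}y^{1/2}z=1$, i.e. $x^{1/2}y^{1/2}=d$ and $x^{1/2}y^{ -1/2}=A/B$. **Virtual link diagrams, states, Kauffman bracket.** A virtual link diagram is like an ordinary planar link diagram except that some crossings are designated virtual (to be ignored, as artifacts of the planar drawing); the others are classical. At a classical crossing, the $A$-splitting is obtained by joining the two vertical angles swept out by the overcrossing arc when it is rotated counterclockwise toward the undercrossing arc; the $B$-splitting joins the other two vertical angles. A state $s$ of $L$ is a choice of an $A$- or $B$-splitting at each classical crossing; $\mathcal S(L)$ is the set of states. $\alpha(s),\beta(s)$ are the numbers of $A$- and $B$-splittings in $s$, and $\delta(s)$ is the number of components (state circles) of the curve obtained by splitting $L$ according to $s$ (virtual crossings do not connect components). The Kauffman bracket is $$[L](A,B,d):=\sum_{s\in\mathcal S(L)}A^{\alpha(s)}B^{\beta(s)}d^{\,\delta(s)-1}.$$ **The ribbon graph $G_L^s$.** Its vertices are obtained by gluing a disc to each state circle of $s$ (regarded as an abstract circle, ignoring virtual crossings). For each classical crossing place near it a small planar band (rectangle) connecting the two strands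 of the splitting of $s$; these bands are the edges. The orientation of the plane induces orientations of the bands and hence arrows on the state circles along the two sides where the band meets them; the resulting circles with arrows (labeled by crossings) determine $G_L^s$ by its arrow presentation. The edge has sign $+1$ if the crossing is resolved by an $A$-splitting in $s$ and $-1$ if by a $B$-splitting. -}

module Defs where

open import Algebra.Bundles using (CommutativeRing)
open import Algebra.Definitions using (Involutive)
open import Data.Bool using (if_then_else_)
open import Data.Fin using (Fin)
open import Data.Fin.Patterns using (0F; 1F; 2F; 3F)
import Data.Fin.Properties as Fin
open import Data.Fin.Subset using (Subset; Side; inside; outside; ∁; _∩_; ∣_∣; ⊤)
open import Data.Fin.Subset.Properties using (_∈?_)
open import Data.Integer as ℤ using (ℤ; +_; -[1+_]; _⊖_)
open import Data.List using (List; []; _∷_; _++_; map; foldr; filter; length; deduplicate; concatMap; allFin; cartesianProduct; cartesianProductWith)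
open import Data.List.Membership.Propositional using (_∈_)
import Data.List.Membership.DecPropositional as DecMembership
open import Data.List.Membership.Propositional.Properties using (∈-cartesianProduct⁺; ∈-++⁺ˡ; ∈-++⁺ʳ; ∈-map⁺; ∈-allFin)
open import Data.List.Relation.Unary.Any using (here; there)
open import Data.Nat using (ℕ; zero; suc; _+_; _*_)
open import Data.Product using (_×_; _,_; proj₁; proj₂)
open import Data.Product.Properties using () renaming (≡-dec to ×-≡-dec)
open import Data.Sign using (Sign) renaming (+ to pos; - to neg)
import Data.Sign.Properties as Sign
open import Data.Sum using (_⊎_; inj₁; inj₂)
import Data.Sum.Properties as Sum
open import Data.Vec using (Vec; []; _∷_; lookup; tabulate; count)
open import Level using (_⊔_)
open import Function using (Injective; _⇔_; mk⇔)
open import Relation.Binary.Construct.Closure.Equivalence as Eq using (EqClosure)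
import Relation.Binary.Construct.Closure.Symmetric as Sym
open import Relation.Binary.Construct.Closure.ReflexiveTransitive using (ε; _◅_)
open import Relation.Binary.Definitions using (DecidableEquality)
open import Relation.Binary.PropositionalEquality as ≡ using (_≡_; _≢_; refl; cong)
open import Relation.Nullary using (Dec; yes; no; does; ¬?; contradiction)

------------------------------------------------------------------------
-- Connected components of finite multigraphs

module Graph {P : Set} (_≟_ : DecidableEquality P) where

  Adjacent : List (P × P) → P → P → Set
  Adjacent es a b = (a , b) ∈ es

  merge : P × P → (P → P) → (P → P)
  merge (a , b) ρ x = if does (ρ x ≟ ρ b) then ρ a else ρ x

  -- A representative of the connected component of a point (union-find).
  rep : List (P × P) → P → P
  rep = foldr merge (λ x → x)

  components : List P → List (P × P) → ℕ
  components ps es = length (deduplicate _≟_ (map (rep es) ps))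

  private
    weaken : ∀ {e es x y} → EqClosure (Adjacent es) x y → EqClosure (Adjacent (e ∷ es)) x y
    weaken = Eq.map there

    rep-connected : ∀ es x → EqClosure (Adjacent es) (rep es x) x
    rep-connected [] x = ε
    rep-connected ((a , b) ∷ es) x with rep es x ≟ rep es b
    ... | no  _  = weaken (rep-connected es x)
    ... | yes eq =
      trans (weaken (rep-connected es a))
        (Sym.fwd (here refl) ◅
          trans (sym (weaken (rep-connected es b)))
            (≡.subst (λ r → EqClosure (Adjacent _) r x) eq (weaken (rep-connected es x))))
      where
      trans = Eq.transitive (Adjacent ((a , b) ∷ es))
      sym   = Eq.symmetric  (Adjacent ((a , b) ∷ es))

    merge-cong : ∀ e {ρ : P → P} {x y} → ρ x ≡ ρ y → merge e ρ x ≡ merge e ρ y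
    merge-cong (a , b) {ρ} eq =
      cong (λ r → if does (r ≟ ρ b) then ρ a else r) eq

    rep-adjacent : ∀ es {x y} → Adjacent es x y → rep es x ≡ rep es y
    rep-adjacent ((a , b) ∷ es) (there p) = merge-cong (a , b) (rep-adjacent es p)
    rep-adjacent ((a , b) ∷ es) (here refl) with rep es a ≟ rep es b | rep es b ≟ rep es b
    ... | yes _ | yes _ = refl
    ... | no  _ | yes _ = refl
    ... | _     | no ¬p = contradiction refl ¬p

  rep-correct : ∀ es x y → rep es x ≡ rep es y ⇔ EqClosure (Adjacent es) x y
  rep-correct es x y = mk⇔ to from
    where
    to : rep es x ≡ rep es y → EqClosure (Adjacent es) x y
    to eq = Eq.transitive _ (Eq.symmetric _ (rep-connected es x))
      (≡.subst (λ r → EqClosure (Adjacent es) r y) (≡.sym eq) (rep-connected es y))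
    from : EqClosure (Adjacent es) x y → rep es x ≡ rep es y
    from = Eq.gfold ≡.isEquivalence (rep es) (rep-adjacent es)

record Matching (P : Set) : Set where
  field
    partner    : P → P
    involutive : Involutive _≡_ partner
    no-fixed   : ∀ p → partner p ≢ p

  pairs : List P → List (P × P)
  pairs = map (λ p → p , partner p)

open Matching using (partner; pairs)

------------------------------------------------------------------------
-- Closed curves

-- A finite disjoint union of circles, up to homeomorphism.  Every circle that
-- carries marked points is cut by them into intervals which belong alternately
-- to two classes, `arc` and `seg`; each class joins every marked point to
-- exactly one other.  `unmarked` counts the circles without marked points.
record Curve : Set₁ where
  field
    Point    : Set
    _≟_      : DecidableEquality Point
    points   : List Point
    complete : ∀ p → p ∈ points
    arc      : Matching Point
    seg      : Matching Point
    unmarked : ℕ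

  open Graph _≟_ public

  arcs segs : List (Point × Point)
  arcs = pairs arc points
  segs = pairs seg points

  #circles : ℕ
  #circles = components points (arcs ++ segs) + unmarked

------------------------------------------------------------------------
-- Ribbon graphs

data Tip : Set where
  tail head : Tip

-- An arrow presentation with labels Fin edges; label i is carried by the
-- arrows (i , 0F) and (i , 1F).  An arrow occupies one interval of class
-- `seg`; intervals of class `seg` without an arrow are allowed.  Circles are
-- not oriented: an arrow is given by its two ends, so that reversing a circle
-- together with its arrows changes nothing.
record RibbonGraph : Set₁ where
  field
    vertexCircles : Curve
  open Curve vertexCircles public
  field
    edges           : ℕ
    arrow           : Fin edges × Fin 2 × Tip → Point
    arrow-injective : Injective _≡_ _≡_ arrow
    arrow-on-seg    : ∀ i a → partner seg (arrow (i , a , tail)) ≡ arrow (i , a , head)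

  open DecMembership _≟_ using () renaming (_∈?_ to _∈ᴾ?_)

  -- A spanning subgraph is given by its set of edges.
  Spanning : Set
  Spanning = Subset edges

  members : Spanning → List (Fin edges)
  members F = filter (_∈? F) (allFin edges)

  -- The boundary of the rectangle i, oriented coherently with both arrows,
  -- leaves each arrow at its head and enters the other one at its tail.
  sides : Fin edges → List (Point × Point)
  sides i = (arrow (i , 0F , head) , arrow (i , 1F , tail))
          ∷ (arrow (i , 1F , head) , arrow (i , 0F , tail))
          ∷ []

  attached : Fin edges → List Point
  attached i = arrow (i , 0F , tail) ∷ arrow (i , 0F , head)
             ∷ arrow (i , 1F , tail) ∷ arrow (i , 1F , head) ∷ []

  -- The intervals of class `seg` along which no edge of F is attached.
  freeSegs : Spanning → List (Point × Point)
  freeSegs F = filter (λ e → ¬? (proj₁ e ∈ᴾ? concatMap attached (members F))) segs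

  v : ℕ
  v = #circles

  e : Spanning → ℕ
  e F = ∣ F ∣

  k : Spanning → ℕ
  k F = components points (arcs ++ segs ++ concatMap sides (members F)) + unmarked

  f : Spanning → ℕ
  f F = components points (arcs ++ freeSegs F ++ concatMap sides (members F)) + unmarked

  r : Spanning → ℤ
  r F = v ⊖ k F

  n : Spanning → ℤ
  n F = + e F ℤ.- r F

  whole : Spanning
  whole = ⊤

record SignedRibbonGraph : Set₁ where
  field
    ribbonGraph : RibbonGraph
  open RibbonGraph ribbonGraph public
  field
    sign : Fin edges → Sign

  e₋ : Spanning → ℕ
  e₋ F = ∣ F ∩ tabulate (λ i → does (sign i Sign.≟ neg)) ∣

  -- s(F) may be a half-integer; this is 2 s(F).
  2s : Spanning → ℤ
  2s F = e₋ F ⊖ e₋ (∁ F)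

words : {X : Set} → List X → ∀ m → List (Vec X m)
words xs zero    = [] ∷ []
words xs (suc m) = cartesianProductWith _∷_ xs (words xs m)

𝓕 : (G : SignedRibbonGraph) → List (SignedRibbonGraph.Spanning G)
𝓕 G = words (inside ∷ outside ∷ []) (SignedRibbonGraph.edges G)

------------------------------------------------------------------------
-- Virtual link diagrams

-- The four half-edges at a crossing are numbered counterclockwise.  At a
-- classical crossing the overcrossing arc consists of 0F and 2F, the
-- undercrossing arc of 1F and 3F.
ccw opposite : Fin 4 → Fin 4
ccw 0F = 1F
ccw 1F = 2F
ccw 2F = 3F
ccw 3F = 0F
opposite j = ccw (ccw j)

opposite-involutive : Involutive _≡_ opposite
opposite-involutive 0F = refl
opposite-involutive 1F = refl
opposite-involutive 2F = refl
opposite-involutive 3F = refl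

opposite-no-fixed : ∀ j → opposite j ≢ j
opposite-no-fixed 0F ()
opposite-no-fixed 1F ()
opposite-no-fixed 2F ()
opposite-no-fixed 3F ()

HalfEdge : ℕ → ℕ → Set
HalfEdge c w = (Fin c ⊎ Fin w) × Fin 4

_≟ᴴ_ : ∀ {c w} → DecidableEquality (HalfEdge c w)
_≟ᴴ_ = ×-≡-dec (Sum.≡-dec Fin._≟_ Fin._≟_) Fin._≟_

halfEdges : ∀ c w → List (HalfEdge c w)
halfEdges c w = cartesianProduct (map inj₁ (allFin c) ++ map inj₂ (allFin w)) (allFin 4)

∈-halfEdges : ∀ {c w} (h : HalfEdge c w) → h ∈ halfEdges c w
∈-halfEdges         (inj₁ i , j) = ∈-cartesianProduct⁺ (∈-++⁺ˡ (∈-map⁺ inj₁ (∈-allFin i))) (∈-allFin j)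
∈-halfEdges {c = c} (inj₂ i , j) = ∈-cartesianProduct⁺ (∈-++⁺ʳ (map inj₁ (allFin c)) (∈-map⁺ inj₂ (∈-allFin i))) (∈-allFin j)

-- The underlying 4-valent graph of a diagram, as a combinatorial map: `edge`
-- matches the half-edges, and the cyclic order at a crossing is `ccw`.  The
-- faces are the orbits of "traverse the edge, then turn to the next half-edge".
-- `Planar` is Euler's formula, summed over the connected components.
module PlaneGraph (c w : ℕ) (edge : Matching (HalfEdge c w)) where
  open Graph (_≟ᴴ_ {c} {w})

  turn : HalfEdge c w → HalfEdge c w
  turn (x , j) = x , ccw j

  #crossings #edges #faces #parts : ℕ
  #crossings = c + w
  #edges     = 2 * #crossings
  #faces     = components (halfEdges c w) (map (λ h → h , turn (partner edge h)) (halfEdges c w))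
  #parts     = components (halfEdges c w) (pairs edge (halfEdges c w) ++ map (λ h → h , turn h) (halfEdges c w))

  Planar : Set
  Planar = #crossings + #faces ≡ #edges + 2 * #parts

-- `loops` counts the components of the link that pass through no crossing.
record VirtualLinkDiagram : Set where
  field
    classical : ℕ
    virtual   : ℕ
    edge      : Matching (HalfEdge classical virtual)
    loops     : ℕ
    planar    : PlaneGraph.Planar classical virtual edge

data Splitting : Set where
  A-split B-split : Splitting

isA? : ∀ t → Dec (t ≡ A-split)
isA? A-split = yes refl
isA? B-split = no λ ()

isB? : ∀ t → Dec (t ≡ B-split)
isB? A-split = no λ ()
isB? B-split = yes refl

-- Rotating the overcrossing arc counterclockwise sweeps out the angles between
-- 0F and 1F and between 2F and 3F.  Once these two angles are joined, the
-- strands of the splitting connect 1F with 2F and 3F with 0F.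
strand : Splitting → Fin 4 → Fin 4
strand A-split 0F = 3F
strand A-split 1F = 2F
strand A-split 2F = 1F
strand A-split 3F = 0F
strand B-split 0F = 1F
strand B-split 1F = 0F
strand B-split 2F = 3F
strand B-split 3F = 2F

strand-involutive : ∀ t → Involutive _≡_ (strand t)
strand-involutive A-split 0F = refl
strand-involutive A-split 1F = refl
strand-involutive A-split 2F = refl
strand-involutive A-split 3F = refl
strand-involutive B-split 0F = refl
strand-involutive B-split 1F = refl
strand-involutive B-split 2F = refl
strand-involutive B-split 3F = refl

strand-no-fixed : ∀ t j → strand t j ≢ j
strand-no-fixed A-split 0F ()
strand-no-fixed A-split 1F ()
strand-no-fixed A-split 2F ()
strand-no-fixed A-split 3F ()
strand-no-fixed B-split 0F ()
strand-no-fixed B-split 1F ()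
strand-no-fixed B-split 2F ()
strand-no-fixed B-split 3F ()

-- The corners of the small band at a split crossing are named after the
-- nearest half-edges, so its counterclockwise boundary is 0F, 1F, 2F, 3F.  The
-- arrows are the two sides of the band that lie on the strands.
bandCorner : Splitting → Fin 2 → Tip → Fin 4
bandCorner A-split 0F tail = 1F
bandCorner A-split 0F head = 2F
bandCorner A-split 1F tail = 3F
bandCorner A-split 1F head = 0F
bandCorner B-split 0F tail = 0F
bandCorner B-split 0F head = 1F
bandCorner B-split 1F tail = 2F
bandCorner B-split 1F head = 3F

bandCorner⁻¹ : Splitting → Fin 4 → Fin 2 × Tip
bandCorner⁻¹ A-split 0F = 1F , head
bandCorner⁻¹ A-split 1F = 0F , tail
bandCorner⁻¹ A-split 2F = 0F , head
bandCorner⁻¹ A-split 3F = 1F , tail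
bandCorner⁻¹ B-split 0F = 0F , tail
bandCorner⁻¹ B-split 1F = 0F , head
bandCorner⁻¹ B-split 2F = 1F , tail
bandCorner⁻¹ B-split 3F = 1F , head

bandCorner-inverse : ∀ t a u → bandCorner⁻¹ t (bandCorner t a u) ≡ (a , u)
bandCorner-inverse A-split 0F tail = refl
bandCorner-inverse A-split 0F head = refl
bandCorner-inverse A-split 1F tail = refl
bandCorner-inverse A-split 1F head = refl
bandCorner-inverse B-split 0F tail = refl
bandCorner-inverse B-split 0F head = refl
bandCorner-inverse B-split 1F tail = refl
bandCorner-inverse B-split 1F head = refl

bandCorner-on-strand : ∀ t a → strand t (bandCorner t a tail) ≡ bandCorner t a head
bandCorner-on-strand A-split 0F = refl
bandCorner-on-strand A-split 1F = refl
bandCorner-on-strand B-split 0F = refl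
bandCorner-on-strand B-split 1F = refl

signOf : Splitting → Sign
signOf A-split = pos
signOf B-split = neg

module _ (L : VirtualLinkDiagram) where
  open VirtualLinkDiagram L

  State : Set
  State = Vec Splitting classical

  𝓢 : List State
  𝓢 = words (A-split ∷ B-split ∷ []) classical

  smooth : State → HalfEdge classical virtual → HalfEdge classical virtual
  smooth s (inj₁ i , j) = inj₁ i , strand (lookup s i) j
  smooth s (inj₂ i , j) = inj₂ i , opposite j

  smoothing : State → Matching (HalfEdge classical virtual)
  smoothing s = record
    { partner    = smooth s
    ; involutive = involutive
    ; no-fixed   = no-fixed
    }
    where
    involutive : Involutive _≡_ (smooth s)
    involutive (inj₁ i , j) = cong (inj₁ i ,_) (strand-involutive (lookup s i) j)
    involutive (inj₂ i , j) = cong (inj₂ i ,_) (opposite-involutive j)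
    no-fixed : ∀ h → smooth s h ≢ h
    no-fixed (inj₁ i , j) eq = strand-no-fixed (lookup s i) j (cong proj₂ eq)
    no-fixed (inj₂ i , j) eq = opposite-no-fixed j (cong proj₂ eq)

  stateCurve : State → Curve
  stateCurve s = record
    { Point    = HalfEdge classical virtual
    ; _≟_      = _≟ᴴ_
    ; points   = halfEdges classical virtual
    ; complete = ∈-halfEdges
    ; arc      = edge
    ; seg      = smoothing s
    ; unmarked = loops
    }

  α β δ : State → ℕ
  α s = count isA? s
  β s = count isB? s
  δ s = Curve.#circles (stateCurve s)

  stateRibbonGraph : State → SignedRibbonGraph
  stateRibbonGraph s = record
    { ribbonGraph = record
      { vertexCircles   = stateCurve s
      ; edges           = classical
      ; arrow           = arrow
      ; arrow-injective = arrow-injective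
      ; arrow-on-seg    = λ i a → cong (inj₁ i ,_) (bandCorner-on-strand (lookup s i) a)
      }
    ; sign = λ i → signOf (lookup s i)
    }
    where
    arrow : Fin classical × Fin 2 × Tip → HalfEdge classical virtual
    arrow (i , a , u) = inj₁ i , bandCorner (lookup s i) a u
    arrow-injective : Injective _≡_ _≡_ arrow
    arrow-injective {i , a , u} {i′ , a′ , u′} eq with Sum.inj₁-injective (cong proj₁ eq)
    ... | refl = cong (i ,_) (≡.trans (≡.sym (bandCorner-inverse (lookup s i) a u))
                   (≡.trans (cong (λ h → bandCorner⁻¹ (lookup s i) (proj₂ h)) eq)
                            (bandCorner-inverse (lookup s i) a′ u′)))

------------------------------------------------------------------------
-- The polynomials, evaluated at units of a commutative ring

module Evaluation {a ℓ} (K : CommutativeRing a ℓ) where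
  open CommutativeRing K renaming (_+_ to _+ᴷ_; _*_ to _*ᴷ_)
  open import Algebra.Properties.Semiring.Exp semiring using () renaming (_^_ to _^ℕ_)

  record Unit : Set (a ⊔ ℓ) where
    field
      val     : Carrier
      inv     : Carrier
      val*inv : val *ᴷ inv ≈ 1#
  open Unit public using (val; inv)

  infixr 8 _^_
  _^_ : Unit → ℤ → Carrier
  u ^ (+ m)     = val u ^ℕ m
  u ^ -[1+ m ]  = inv u ^ℕ suc m

  sum : List Carrier → Carrier
  sum = foldr _+ᴷ_ 0#

  kauffman : VirtualLinkDiagram → (A B d : Unit) → Carrier
  kauffman L A B d = sum (map term (𝓢 L))
    where
    term : State L → Carrier
    term s = A ^ (+ α L s) *ᴷ B ^ (+ β L s) *ᴷ d ^ (+ δ L s ℤ.- + 1)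

  -- The arguments are x^{1/2}, y^{1/2} and z, so the exponents of x and y are
  -- doubled.
  bollobásRiordan : SignedRibbonGraph → (√x √y z : Unit) → Carrier
  bollobásRiordan G √x √y z = sum (map term (𝓕 G))
    where
    open SignedRibbonGraph G
    term : Spanning → Carrier
    term F = √x ^ (+ 2 ℤ.* (r whole ℤ.- r F) ℤ.+ 2s F)
          *ᴷ √y ^ (+ 2 ℤ.* n F ℤ.- 2s F)
          *ᴷ z  ^ (k F ⊖ f F ℤ.+ n F)

-- The states of L correspond to the spanning subgraphs F of G_L^s: let s′ differ from
-- s exactly at the edges of F.  At such a crossing the two free sides of the band
-- are the strands of the other splitting, so the boundary of F is the curve of s′ and
-- f(F) = δ(s′).  Moreover β(s′) = e(F) − 2s(F).  In √x, √y and B both sides become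
-- sums of Laurent monomials that agree term by term; v(G), k(G) and k(F) cancel.

module Submission where

open import Algebra.Bundles using (CommutativeRing)
import Algebra.Properties.CommutativeSemigroup as CommutativeSemigroupProperties
import Algebra.Properties.CommutativeSemiring.Exp as Exp
open import Data.Bool using (true; false; if_then_else_)
open import Data.Fin using (Fin; zero; suc)
open import Data.Fin.Patterns using (0F; 1F; 2F; 3F)
open import Data.Fin.Subset as Subset using (Subset; inside; outside; ∁; _∩_; ∣_∣; _∉_)
open import Data.Fin.Subset.Properties using (_∈?_; ∣⊤∣≡n)
open import Data.Integer as ℤ using (ℤ; +_; -[1+_]; _⊖_)
import Data.Integer.Properties as ℤₚ
open import Data.Integer.Tactic.RingSolver using (solve-∀)
open import Data.List using (List; []; _∷_; _++_; map; filter; length; deduplicate; concatMap; allFin)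
open import Data.List.Membership.Propositional using (_∈_; find; lose)
open import Data.List.Membership.Propositional.Properties
  using (∈-++⁺ˡ; ∈-++⁺ʳ; ∈-++⁻; ∈-map⁺; ∈-map⁻; ∈-filter⁺; ∈-filter⁻; ∈-concatMap⁺; ∈-concatMap⁻; ∈-allFin)
open import Data.List.Properties using (filter-≐; length-map; map-++; map-∘; ++-identityʳ)
open import Data.List.Relation.Unary.Any using (here; there)
open import Data.Nat as ℕ using (ℕ; zero; suc)
import Data.Nat.Properties as ℕₚ
open import Data.Product using (_×_; _,_; proj₁; proj₂; ∃)
import Data.Sign as Sign
import Data.Sign.Properties as Signₚ
open import Data.Sum using (inj₁; inj₂)
open import Data.Vec using (Vec; []; _∷_; lookup; tabulate; count; zipWith)
open import Data.Vec.Properties using (lookup-zipWith; []=⇒lookup; lookup⇒[]=)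
open import Function using (_∘_; _⇔_; mk⇔; Equivalence)
import Function.Construct.Composition as Composition
import Function.Construct.Symmetry as Symmetry
open import Relation.Binary.Construct.Closure.Equivalence as Eq using (EqClosure)
open import Relation.Binary.Definitions using (DecidableEquality)
import Relation.Binary.Construct.Closure.Symmetric as Sym
import Relation.Binary.Construct.Closure.ReflexiveTransitive as Star
open import Relation.Binary.PropositionalEquality as ≡ using (_≡_; refl; cong; cong₂; module ≡-Reasoning)
import Relation.Binary.Reasoning.Setoid as SetoidReasoning
open import Relation.Nullary using (¬_; yes; no; does; ¬?; contradiction)
open import Relation.Unary using (Pred; Decidable)
open import Defs

-- Deduplication and the number of connected components.

map-filter : ∀ {X Y : Set} {p} {P : Pred Y p} (P? : Decidable P) (f : X → Y) xs →
  filter P? (map f xs) ≡ map f (filter (P? ∘ f) xs)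
map-filter P? f []       = refl
map-filter P? f (x ∷ xs) with does (P? (f x))
... | true  = cong (f x ∷_) (map-filter P? f xs)
... | false = map-filter P? f xs

module _ {X Y : Set} (_≟_ : DecidableEquality Y) where

  deduplicate-map : (f : X → Y) → ∀ xs →
    deduplicate _≟_ (map f xs) ≡ map f (deduplicate (λ x y → f x ≟ f y) xs)
  deduplicate-map f []       = refl
  deduplicate-map f (x ∷ xs) = cong (f x ∷_)
    (≡.trans (cong (filter (¬? ∘ (f x ≟_))) (deduplicate-map f xs))
      (map-filter (¬? ∘ (f x ≟_)) f (deduplicate (λ x y → f x ≟ f y) xs)))

  -- Deduplication only asks which elements have equal images, so it sees the kernel of a map and
  -- not its values.
  deduplicate-kernel : (f g : X → Y) → (∀ x y → f x ≡ f y ⇔ g x ≡ g y) → ∀ xs →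
    deduplicate (λ x y → f x ≟ f y) xs ≡ deduplicate (λ x y → g x ≟ g y) xs
  deduplicate-kernel f g f⇔g []       = refl
  deduplicate-kernel f g f⇔g (x ∷ xs) = cong (x ∷_)
    (≡.trans (cong (filter _) (deduplicate-kernel f g f⇔g xs))
      (filter-≐ (λ y → ¬? (f x ≟ f y)) (λ y → ¬? (g x ≟ g y))
        ((_∘ Equivalence.from (f⇔g x _)) , (_∘ Equivalence.to (f⇔g x _)))
        (deduplicate (λ x y → g x ≟ g y) xs)))

module _ {P : Set} (_≟_ : DecidableEquality P) where
  open Graph _≟_

  -- The representatives chosen by `rep` depend on the order of the edge list, but by `rep-correct`
  -- their kernel is the generated equivalence relation. Two lists whose edges are connected through
  -- each other therefore give the same count.
  components-cong : ∀ ps es es′ →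
    (∀ {x y} → Adjacent es  x y → EqClosure (Adjacent es′) x y) →
    (∀ {x y} → Adjacent es′ x y → EqClosure (Adjacent es)  x y) →
    components ps es ≡ components ps es′
  components-cong ps es es′ es⇒es′ es′⇒es = begin
    length (deduplicate _≟_ (map (rep es) ps))                   ≡⟨ count-kernel es ⟩
    length (deduplicate (λ x y → rep es x ≟ rep es y) ps)         ≡⟨ cong length (deduplicate-kernel _≟_ _ _ kernel ps) ⟩
    length (deduplicate (λ x y → rep es′ x ≟ rep es′ y) ps)       ≡⟨ count-kernel es′ ⟨
    length (deduplicate _≟_ (map (rep es′) ps))                  ∎
    where
    open ≡-Reasoning
    count-kernel : ∀ es → length (deduplicate _≟_ (map (rep es) ps))
                        ≡ length (deduplicate (λ x y → rep es x ≟ rep es y) ps)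
    count-kernel es = ≡.trans (cong length (deduplicate-map _≟_ (rep es) ps))
      (length-map (rep es) (deduplicate (λ x y → rep es x ≟ rep es y) ps))
    kernel : ∀ x y → rep es x ≡ rep es y ⇔ rep es′ x ≡ rep es′ y
    kernel x y = Composition.equivalence (rep-correct es x y)
      (Composition.equivalence (mk⇔ (Eq._⋆ es⇒es′) (Eq._⋆ es′⇒es))
        (Symmetry.equivalence (rep-correct es′ x y)))

-- Changing a state at a set of crossings.

other : Splitting → Splitting
other A-split = B-split
other B-split = A-split

flipIf : Splitting → Subset.Side → Splitting
flipIf t b = if b then other t else t

-- The bijection 𝓕(G_L^s) ≅ 𝓢(L): change the splitting of s at the edges of F.
resplit : ∀ {m} → Vec Splitting m → Subset m → Vec Splitting m
resplit = zipWith flipIf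

module _ {m} (s : Vec Splitting m) (F : Subset m) {i : Fin m} where

  resplit-∈ : i Subset.∈ F → lookup (resplit s F) i ≡ other (lookup s i)
  resplit-∈ i∈F = ≡.trans (lookup-zipWith flipIf i s F) (cong (flipIf (lookup s i)) ([]=⇒lookup i∈F))

  resplit-∉ : i ∉ F → lookup (resplit s F) i ≡ lookup s i
  resplit-∉ i∉F with lookup F i in eq | lookup-zipWith flipIf i s F
  ... | true  | _ = contradiction (lookup⇒[]= i F eq) i∉F
  ... | false | p = p

α+β≡m : ∀ {m} (t : Vec Splitting m) → count isA? t ℕ.+ count isB? t ≡ m
α+β≡m []            = refl
α+β≡m (A-split ∷ t) = cong suc (α+β≡m t)
α+β≡m (B-split ∷ t) = ≡.trans (ℕₚ.+-suc _ _) (cong suc (α+β≡m t))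

-- Written so that it agrees by computation with the set of negative edges that `e₋` intersects with
-- in `stateRibbonGraph`.
negative : ∀ {m} → Vec Splitting m → Subset m
negative s = tabulate (λ i → does (signOf (lookup s i) Signₚ.≟ Sign.-))

-- The relation β(s′) = e(F) - 2s(F), stated without subtraction. It holds crossing by crossing: a
-- changed A-splitting counts in β(s′) and e(F), a changed B-splitting in e₋(F) and e(F), a kept
-- B-splitting in β(s′) and in e₋ of the complement, a kept A-splitting nowhere.
β-resplit : ∀ {m} (s : Vec Splitting m) (F : Subset m) →
  count isB? (resplit s F) ℕ.+ ∣ F ∩ negative s ∣ ≡ ∣ F ∣ ℕ.+ ∣ ∁ F ∩ negative s ∣
β-resplit []            []            = refl
β-resplit (A-split ∷ s) (inside  ∷ F) = cong suc (β-resplit s F)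
β-resplit (A-split ∷ s) (outside ∷ F) = β-resplit s F
β-resplit (B-split ∷ s) (inside  ∷ F) = ≡.trans (ℕₚ.+-suc _ _) (cong suc (β-resplit s F))
β-resplit (B-split ∷ s) (outside ∷ F) = ≡.trans (cong suc (β-resplit s F)) (≡.sym (ℕₚ.+-suc _ _))

-- The boundary of a spanning subgraph as a state curve.

module _ (L : VirtualLinkDiagram) (s : State L) where
  open VirtualLinkDiagram L
  open SignedRibbonGraph (stateRibbonGraph L s)

  -- Each of the four half-edges is a corner of the band, so an edge in F removes both strands of
  -- its crossing from the free segments.
  attached⁺ : ∀ i j → (inj₁ i , j) ∈ attached i
  attached⁺ i j with lookup s i
  attached⁺ i 0F | A-split = there (there (there (here refl)))
  attached⁺ i 1F | A-split = here refl
  attached⁺ i 2F | A-split = there (here refl)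
  attached⁺ i 3F | A-split = there (there (here refl))
  attached⁺ i 0F | B-split = here refl
  attached⁺ i 1F | B-split = there (here refl)
  attached⁺ i 2F | B-split = there (there (here refl))
  attached⁺ i 3F | B-split = there (there (there (here refl)))

  attached⁻ : ∀ i {h} → h ∈ attached i → proj₁ h ≡ inj₁ i
  attached⁻ i (here refl)                         = refl
  attached⁻ i (there (here refl))                 = refl
  attached⁻ i (there (there (here refl)))         = refl
  attached⁻ i (there (there (there (here refl)))) = refl

  -- The geometric core: the two sides of the band not glued to the circles run parallel to the
  -- strands of the opposite splitting. The symmetric closure is needed because `sides` lists each
  -- side in one direction only, while `j` ranges over both ends.
  sides⁺ : ∀ i j → Sym.SymClosure (Graph.Adjacent _≟_ (sides i))
                     (inj₁ i , j) (inj₁ i , strand (other (lookup s i)) j)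
  sides⁺ i j with lookup s i
  sides⁺ i 0F | A-split = Sym.fwd (there (here refl))
  sides⁺ i 1F | A-split = Sym.bwd (there (here refl))
  sides⁺ i 2F | A-split = Sym.fwd (here refl)
  sides⁺ i 3F | A-split = Sym.bwd (here refl)
  sides⁺ i 0F | B-split = Sym.bwd (there (here refl))
  sides⁺ i 1F | B-split = Sym.fwd (here refl)
  sides⁺ i 2F | B-split = Sym.bwd (here refl)
  sides⁺ i 3F | B-split = Sym.fwd (there (here refl))

  sides⁻ : ∀ i {g h} → (g , h) ∈ sides i →
    ∃ λ j → g ≡ (inj₁ i , j) × h ≡ (inj₁ i , strand (other (lookup s i)) j)
  sides⁻ i p with lookup s i
  sides⁻ i (here refl)         | A-split = 2F , refl , refl
  sides⁻ i (there (here refl)) | A-split = 0F , refl , refl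
  sides⁻ i (here refl)         | B-split = 1F , refl , refl
  sides⁻ i (there (here refl)) | B-split = 3F , refl , refl

  module _ (F : Spanning) where
    private
      s′ : State L
      s′ = resplit s F

      smooth-∈ : ∀ {i} → i Subset.∈ F → ∀ j →
        smooth L s′ (inj₁ i , j) ≡ (inj₁ i , strand (other (lookup s i)) j)
      smooth-∈ {i} i∈F j = cong (λ t → inj₁ i , strand t j) (resplit-∈ s F i∈F)

      smooth-∉ : ∀ {i} → i ∉ F → ∀ j → smooth L s′ (inj₁ i , j) ≡ smooth L s (inj₁ i , j)
      smooth-∉ {i} i∉F j = cong (λ t → inj₁ i , strand t j) (resplit-∉ s F i∉F)

      AttachedAlongF : HalfEdge classical virtual → Set
      AttachedAlongF h = h ∈ concatMap attached (members F)

      attachedAlongF⁻ : ∀ {h} → AttachedAlongF h → ∃ λ i → i Subset.∈ F × proj₁ h ≡ inj₁ i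
      attachedAlongF⁻ {h} p with find (∈-concatMap⁻ attached {xs = members F} p)
      ... | i , i∈ , h∈ = i , proj₂ (∈-filter⁻ (_∈? F) {xs = allFin _} i∈) , attached⁻ i h∈

      ∈-members : ∀ {i} → i Subset.∈ F → i ∈ members F
      ∈-members i∈F = ∈-filter⁺ (_∈? F) (∈-allFin _) i∈F

      attachedAlongF⁺ : ∀ {i j} → i Subset.∈ F → AttachedAlongF (inj₁ i , j)
      attachedAlongF⁺ i∈F = ∈-concatMap⁺ attached (lose (∈-members i∈F) (attached⁺ _ _))

      sidesF boundary : List (Point × Point)
      sidesF   = concatMap sides (members F)
      boundary = freeSegs F ++ sidesF

      segs′ : List (Point × Point)
      segs′ = Curve.segs (stateCurve L s′)

      SymAdjacent : List (Point × Point) → Point → Point → Set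
      SymAdjacent es = Sym.SymClosure (Graph.Adjacent _≟_ es)

      segs′⁺ : ∀ h → (h , smooth L s′ h) ∈ segs′
      segs′⁺ h = ∈-map⁺ (λ h → h , smooth L s′ h) (∈-halfEdges h)

      free⁺ : ∀ h → ¬ AttachedAlongF h → (h , smooth L s h) ∈ boundary
      free⁺ h h∉ = ∈-++⁺ˡ (∈-filter⁺ _ (∈-map⁺ (λ h → h , smooth L s h) (∈-halfEdges h)) h∉)

      -- At a crossing in F the strand of s′ is a side of the band; at any other crossing it is a
      -- strand of s with no band of F attached.
      smooth⇒boundary : ∀ h → SymAdjacent boundary h (smooth L s′ h)
      -- At a virtual crossing `smooth` ignores the state, so the strands of s and s′ coincide by
      -- computation.
      smooth⇒boundary h@(inj₂ _ , _) = Sym.fwd (free⁺ h not-attached)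
        where
        not-attached : ¬ AttachedAlongF h
        not-attached p with attachedAlongF⁻ p
        ... | _ , _ , ()
      smooth⇒boundary h@(inj₁ i , j) with i ∈? F
      ... | yes i∈F = ≡.subst (SymAdjacent boundary h) (≡.sym (smooth-∈ i∈F j))
              (Sym.map (λ p → ∈-++⁺ʳ (freeSegs F) (∈-concatMap⁺ sides (lose (∈-members i∈F) p))) (sides⁺ i j))
      ... | no  i∉F = ≡.subst (SymAdjacent boundary h) (≡.sym (smooth-∉ i∉F j))
              (Sym.fwd (free⁺ h not-attached))
        where
        not-attached : ¬ AttachedAlongF h
        not-attached p with attachedAlongF⁻ p
        ... | _ , i∈F , refl = i∉F i∈F

      segs′⇒boundary : ∀ {g h} → (g , h) ∈ segs′ → SymAdjacent boundary g h
      segs′⇒boundary p with ∈-map⁻ _ {xs = points} p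
      ... | h , _ , refl = smooth⇒boundary h

      free⇒segs′ : ∀ h → ¬ AttachedAlongF h → (h , smooth L s h) ∈ segs′
      free⇒segs′ h@(inj₂ _ , _) _  = segs′⁺ h
      free⇒segs′ h@(inj₁ i , j) h∉ =
        ≡.subst (λ g → (h , g) ∈ segs′) (smooth-∉ (h∉ ∘ attachedAlongF⁺) j) (segs′⁺ h)

      -- Plain membership suffices in this direction, since `segs′` lists every strand from both of
      -- its ends.
      boundary⇒segs′ : ∀ {g h} → (g , h) ∈ boundary → (g , h) ∈ segs′
      boundary⇒segs′ p with ∈-++⁻ (freeSegs F) p
      boundary⇒segs′ p | inj₁ q with ∈-filter⁻ _ {xs = segs} q
      ... | q∈ , h∉ with ∈-map⁻ _ {xs = points} q∈
      ... | h , _ , refl = free⇒segs′ h h∉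
      boundary⇒segs′ p | inj₂ q with find (∈-concatMap⁻ sides {xs = members F} q)
      ... | i , i∈ , r with sides⁻ i r
      ... | j , refl , refl = ≡.subst (λ g → ((inj₁ i , j) , g) ∈ segs′)
              (smooth-∈ (proj₂ (∈-filter⁻ (_∈? F) {xs = allFin _} i∈)) j) (segs′⁺ _)

    f≡δ : f F ≡ δ L (resplit s F)
    -- The arcs and the crossingless loops are the same for all states, so only the intervals near
    -- the crossings have to be compared.
    f≡δ = cong (ℕ._+ unmarked) (components-cong _≟_ points (arcs ++ boundary) (arcs ++ segs′)
      to from)
      where
      to : ∀ {g h} → (g , h) ∈ arcs ++ boundary → EqClosure (Graph.Adjacent _≟_ (arcs ++ segs′)) g h
      to p with ∈-++⁻ arcs p
      ... | inj₁ q = Eq.return (∈-++⁺ˡ q)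
      ... | inj₂ q = Eq.return (∈-++⁺ʳ arcs (boundary⇒segs′ q))
      from : ∀ {g h} → (g , h) ∈ arcs ++ segs′ → EqClosure (Graph.Adjacent _≟_ (arcs ++ boundary)) g h
      from p with ∈-++⁻ arcs p
      ... | inj₁ q = Eq.return (∈-++⁺ˡ q)
      ... | inj₂ q = Eq.map (∈-++⁺ʳ arcs) (segs′⇒boundary q Star.◅ Star.ε)

-- Integer powers of units and Laurent monomials.

module LaurentMonomials {a ℓ} (K : CommutativeRing a ℓ) where
  open CommutativeRing K renaming (refl to ≈-refl; sym to ≈-sym; trans to ≈-trans; reflexive to ≈-reflexive)
    hiding (zero)
  open Evaluation K
  open Exp commutativeSemiring using (^-congˡ; ^-homo-*; ^-distrib-*) renaming (_^_ to _^ℕ_)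
  open CommutativeSemigroupProperties *-commutativeSemigroup using () renaming (interchange to *-interchange)
  open SetoidReasoning setoid

  infixl 7 _⊗_
  infix  9 _⁻¹

  _⊗_ : Unit → Unit → Unit
  u ⊗ w = record
    { val     = val u * val w
    ; inv     = inv u * inv w
    ; val*inv = ≈-trans (*-interchange _ _ _ _)
                  (≈-trans (*-cong (Unit.val*inv u) (Unit.val*inv w)) (*-identityˡ 1#))
    }

  _⁻¹ : Unit → Unit
  u ⁻¹ = record { val = inv u ; inv = val u ; val*inv = ≈-trans (*-comm _ _) (Unit.val*inv u) }

  -- Uniqueness of inverses. It lets negative powers respect equality of values, although a `Unit`
  -- carries its inverse as data.
  inv-cong : ∀ u w → val u ≈ val w → inv u ≈ inv w
  inv-cong u w u≈w = begin
    inv u                     ≈⟨ *-identityʳ _ ⟨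
    inv u * 1#                ≈⟨ *-congˡ (Unit.val*inv w) ⟨
    inv u * (val w * inv w)   ≈⟨ *-congˡ (*-congʳ u≈w) ⟨
    inv u * (val u * inv w)   ≈⟨ *-assoc _ _ _ ⟨
    inv u * val u * inv w     ≈⟨ *-congʳ (Unit.val*inv (u ⁻¹)) ⟩
    1# * inv w                ≈⟨ *-identityˡ _ ⟩
    inv w                     ∎

  ^-cong : ∀ u w → val u ≈ val w → ∀ i → u ^ i ≈ w ^ i
  ^-cong u w u≈w (+ m)    = ^-congˡ m u≈w
  ^-cong u w u≈w -[1+ m ] = ^-congˡ (suc m) (inv-cong u w u≈w)

  ^-⊗ : ∀ u w i → (u ⊗ w) ^ i ≈ u ^ i * w ^ i
  ^-⊗ u w (+ m)    = ^-distrib-* (val u) (val w) m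
  ^-⊗ u w -[1+ m ] = ^-distrib-* (inv u) (inv w) (suc m)

  ^-⁻¹ : ∀ u i → (u ⁻¹) ^ i ≈ u ^ (ℤ.- i)
  ^-⁻¹ u (+ zero)  = ≈-refl
  ^-⁻¹ u (+ suc m) = ≈-refl
  ^-⁻¹ u -[1+ m ]  = ≈-refl

  -- Supplies the mixed-sign cases of `^-+`; each common successor is absorbed by one factor
  -- `val u * inv u`.
  ^-⊖ : ∀ u m n → u ^ (m ⊖ n) ≈ val u ^ℕ m * inv u ^ℕ n
  ^-⊖ u zero    zero    = ≈-sym (*-identityˡ 1#)
  ^-⊖ u zero    (suc n) = ≈-sym (*-identityˡ _)
  ^-⊖ u (suc m) zero    = ≈-sym (*-identityʳ _)
  ^-⊖ u (suc m) (suc n) = begin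
    u ^ (suc m ⊖ suc n)                               ≈⟨ ≈-reflexive (cong (u ^_) (ℤₚ.[1+m]⊖[1+n]≡m⊖n m n)) ⟩
    u ^ (m ⊖ n)                                       ≈⟨ ^-⊖ u m n ⟩
    val u ^ℕ m * inv u ^ℕ n                           ≈⟨ *-identityˡ _ ⟨
    1# * (val u ^ℕ m * inv u ^ℕ n)                    ≈⟨ *-congʳ (Unit.val*inv u) ⟨
    val u * inv u * (val u ^ℕ m * inv u ^ℕ n)         ≈⟨ *-interchange _ _ _ _ ⟩
    val u ^ℕ suc m * inv u ^ℕ suc n                   ∎

  ^-+ : ∀ u i j → u ^ (i ℤ.+ j) ≈ u ^ i * u ^ j
  ^-+ u (+ m)    (+ n)    = ^-homo-* (val u) m n
  ^-+ u (+ m)    -[1+ n ] = ^-⊖ u m (suc n)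
  ^-+ u -[1+ m ] (+ n)    = ≈-trans (^-⊖ u n (suc m)) (*-comm _ _)
  ^-+ u -[1+ m ] -[1+ n ] =
    ≈-trans (≈-reflexive (cong (λ k → inv u ^ℕ suc k) (≡.sym (ℕₚ.+-suc m n))))
      (^-homo-* (inv u) (suc m) (suc n))

  -- A record rather than a bare equation, so that the exponents can be inferred from the type when
  -- monomials are multiplied.
  record Monomial (u v w : Unit) (i j k : ℤ) (p : Carrier) : Set ℓ where
    constructor is-monomial
    field ≈-monomial : p ≈ u ^ i * v ^ j * w ^ k
  open Monomial public

  module _ {u v w : Unit} where

    infixl 7 _⊛_
    _⊛_ : ∀ {i j k i′ j′ k′ p q} → Monomial u v w i j k p → Monomial u v w i′ j′ k′ q →
      Monomial u v w (i ℤ.+ i′) (j ℤ.+ j′) (k ℤ.+ k′) (p * q)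
    _⊛_ {i} {j} {k} {i′} {j′} {k′} {p} {q} (is-monomial p≈) (is-monomial q≈) = is-monomial (begin
      p * q                                                     ≈⟨ *-cong p≈ q≈ ⟩
      u ^ i * v ^ j * w ^ k * (u ^ i′ * v ^ j′ * w ^ k′)        ≈⟨ *-interchange _ _ _ _ ⟩
      u ^ i * v ^ j * (u ^ i′ * v ^ j′) * (w ^ k * w ^ k′)      ≈⟨ *-congʳ (*-interchange _ _ _ _) ⟩
      u ^ i * u ^ i′ * (v ^ j * v ^ j′) * (w ^ k * w ^ k′)      ≈⟨ *-cong (*-cong (^-+ u i i′) (^-+ v j j′)) (^-+ w k k′) ⟨
      u ^ (i ℤ.+ i′) * v ^ (j ℤ.+ j′) * w ^ (k ℤ.+ k′)          ∎)

    -- Reduces an equation in the ring to three equations between integer exponents.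
    monomial-≈ : ∀ {i j k i′ j′ k′ p q} → Monomial u v w i j k p → Monomial u v w i′ j′ k′ q →
      i ≡ i′ → j ≡ j′ → k ≡ k′ → p ≈ q
    monomial-≈ p≈ q≈ refl refl refl = ≈-trans (≈-monomial p≈) (≈-sym (≈-monomial q≈))

  -- Finite sums and the reindexing of states by spanning subgraphs.

  sum-cong : ∀ {X : Set} {f g : X → Carrier} → (∀ x → f x ≈ g x) → ∀ xs →
    sum (map f xs) ≈ sum (map g xs)
  sum-cong f≈g []       = ≈-refl
  sum-cong f≈g (x ∷ xs) = +-cong (f≈g x) (sum-cong f≈g xs)

  *-sum : ∀ {X : Set} c (f : X → Carrier) xs → c * sum (map f xs) ≈ sum (map (λ x → c * f x) xs)
  *-sum c f []       = zeroʳ c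
  *-sum c f (x ∷ xs) = ≈-trans (distribˡ c _ _) (+-congˡ (*-sum c f xs))

  sum-++ : ∀ xs ys → sum (xs ++ ys) ≈ sum xs + sum ys
  sum-++ []       ys = ≈-sym (+-identityˡ _)
  sum-++ (x ∷ xs) ys = ≈-trans (+-congˡ (sum-++ xs ys)) (≈-sym (+-assoc _ _ _))

  sum-words : ∀ {X : Set} (x y : X) {m} (g : Vec X (suc m) → Carrier) →
    sum (map g (words (x ∷ y ∷ []) (suc m))) ≈
      sum (map (λ w → g (x ∷ w)) (words (x ∷ y ∷ []) m)) +
      sum (map (λ w → g (y ∷ w)) (words (x ∷ y ∷ []) m))
  sum-words x y {m} g = begin
    -- The trailing `[]` is what `cartesianProductWith` leaves after the second letter.
    sum (map g (map (x ∷_) ws ++ map (y ∷_) ws ++ []))            ≈⟨ ≈-reflexive (cong (λ l → sum (map g (map (x ∷_) ws ++ l))) (++-identityʳ _)) ⟩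
    sum (map g (map (x ∷_) ws ++ map (y ∷_) ws))                  ≈⟨ ≈-reflexive (cong sum (map-++ g (map (x ∷_) ws) _)) ⟩
    sum (map g (map (x ∷_) ws) ++ map g (map (y ∷_) ws))          ≈⟨ sum-++ (map g (map (x ∷_) ws)) _ ⟩
    sum (map g (map (x ∷_) ws)) + sum (map g (map (y ∷_) ws))     ≈⟨ ≈-reflexive (cong₂ (λ l l′ → sum l + sum l′) (map-∘ ws) (map-∘ ws)) ⟨
    sum (map (λ w → g (x ∷ w)) ws) + sum (map (λ w → g (y ∷ w)) ws) ∎
    where ws = words (x ∷ y ∷ []) m

  -- For fixed `s`, both choices at each crossing arise from exactly one of `inside` and `outside`;
  -- the induction splits both sums at the first crossing.
  sum-resplit : ∀ {m} (s : Vec Splitting m) (g : Vec Splitting m → Carrier) →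
    sum (map g (words (A-split ∷ B-split ∷ []) m)) ≈
    sum (map (λ F → g (resplit s F)) (words (inside ∷ outside ∷ []) m))
  sum-resplit []            g = ≈-refl
  sum-resplit (A-split ∷ s) g = begin
    _     ≈⟨ sum-words A-split B-split g ⟩
    _     ≈⟨ +-cong (sum-resplit s (λ t → g (A-split ∷ t))) (sum-resplit s (λ t → g (B-split ∷ t))) ⟩
    -- Here `inside`, which is listed first, yields the B-splitting, so the two halves appear in the
    -- opposite order.
    _     ≈⟨ +-comm _ _ ⟩
    _     ≈⟨ sum-words inside outside (λ F → g (resplit (A-split ∷ s) F)) ⟨
    _     ∎
  sum-resplit (B-split ∷ s) g = begin
    _     ≈⟨ sum-words A-split B-split g ⟩
    _     ≈⟨ +-cong (sum-resplit s (λ t → g (A-split ∷ t))) (sum-resplit s (λ t → g (B-split ∷ t))) ⟩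
    _     ≈⟨ sum-words inside outside (λ F → g (resplit (B-split ∷ s) F)) ⟨
    _     ∎

-- Integer identities between exponents.

-- Turns `β-resplit` into 2s(F) = e(F) - β(s′), with `b` = β(s′), `p` = e₋(F), `c` = e(F) and `q` =
-- e₋ of the complement.
⊖-balance : ∀ b p c q → b ℕ.+ p ≡ c ℕ.+ q → p ⊖ q ≡ + c ℤ.- + b
⊖-balance b p c q b+p≡c+q = begin
  p ⊖ q                                           ≡⟨ ℤₚ.m-n≡m⊖n p q ⟨
  + p ℤ.- + q                                     ≡⟨ shift (+ b) (+ p) (+ q) ⟩
  (+ b ℤ.+ + p) ℤ.- (+ b ℤ.+ + q)                 ≡⟨ cong (ℤ._- (+ b ℤ.+ + q)) (cong +_ b+p≡c+q) ⟩
  (+ c ℤ.+ + q) ℤ.- (+ b ℤ.+ + q)                 ≡⟨ cancel (+ c) (+ b) (+ q) ⟩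
  + c ℤ.- + b                                     ∎
  where
  open ≡-Reasoning
  shift : ∀ b p q → p ℤ.- q ≡ (b ℤ.+ p) ℤ.- (b ℤ.+ q)
  shift = solve-∀
  cancel : ∀ c b q → (c ℤ.+ q) ℤ.- (b ℤ.+ q) ≡ c ℤ.- b
  cancel = solve-∀

-- The exponents of √x, √y and B in a term, once A = √x √y⁻¹ B, d = √x √y,
-- x = √x², y = √y² and z = (√x √y)⁻¹ are substituted.  Here a = α(s′), b = β(s′),
-- D = δ(s′) = f(F), V = v(G), κ = k(G), κF = k(F), c = e(F) and c − b = 2s(F).
x-exponent : ∀ a b D V κ κF c →
  a ℤ.+ + 0 ℤ.+ (D ℤ.- + 1) ≡
  ((a ℤ.+ b) ℤ.+ (κ ℤ.+ κ ℤ.+ + 0 ℤ.+ ℤ.- (+ 1 ℤ.+ V))) ℤ.+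
  ((+ 2 ℤ.* ((V ℤ.- κ) ℤ.- (V ℤ.- κF)) ℤ.+ (c ℤ.- b)) ℤ.+ + 0 ℤ.+
   ℤ.- ((κF ℤ.- D) ℤ.+ (c ℤ.- (V ℤ.- κF))))
x-exponent = solve-∀

y-exponent : ∀ a b D V κF c →
  ℤ.- a ℤ.+ + 0 ℤ.+ (D ℤ.- + 1) ≡
  (ℤ.- (a ℤ.+ b) ℤ.+ (+ 0 ℤ.+ (V ℤ.+ V) ℤ.+ ℤ.- (+ 1 ℤ.+ V))) ℤ.+
  (+ 0 ℤ.+ (+ 2 ℤ.* (c ℤ.- (V ℤ.- κF)) ℤ.- (c ℤ.- b)) ℤ.+
   ℤ.- ((κF ℤ.- D) ℤ.+ (c ℤ.- (V ℤ.- κF))))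
y-exponent = solve-∀

B-exponent : ∀ a b →
  a ℤ.+ b ℤ.+ + 0 ≡ ((a ℤ.+ b) ℤ.+ (+ 0 ℤ.+ + 0 ℤ.+ + 0)) ℤ.+ (+ 0 ℤ.+ + 0 ℤ.+ + 0)
B-exponent = solve-∀

-- Comparison of the two sums term by term.

module _ {a ℓ} (K : CommutativeRing a ℓ) (L : VirtualLinkDiagram) (s : State L) where
  open CommutativeRing K renaming (_*_ to _·_; sym to ≈-sym; trans to ≈-trans; reflexive to ≈-reflexive)
    hiding (zero; refl)
  open Evaluation K
  open LaurentMonomials K
  open VirtualLinkDiagram L using (classical)
  open SetoidReasoning setoid
  private G = stateRibbonGraph L s
  open SignedRibbonGraph G using (Spanning; e; k; v; r; n; f; e₋; 2s; whole)

  module _ (A B d x y z √x √y : Unit)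
    (z≈ : val z ≈ inv d)
    (√x²≈x : val √x · val √x ≈ val x)
    (√y²≈y : val √y · val √y ≈ val y)
    (√x√y≈d : val √x · val √y ≈ val d)
    (√x/√y≈A/B : val √x · inv √y ≈ val A · inv B)
    where

    kauffmanTerm : State L → Carrier
    kauffmanTerm t = A ^ (+ α L t) · B ^ (+ β L t) · d ^ (+ δ L t ℤ.- + 1)

    ribbonTerm : Spanning → Carrier
    ribbonTerm F = √x ^ (+ 2 ℤ.* (r whole ℤ.- r F) ℤ.+ 2s F)
                 · √y ^ (+ 2 ℤ.* n F ℤ.- 2s F)
                 · z  ^ (k F ⊖ f F ℤ.+ n F)

    prefactor : Carrier
    prefactor = A ^ (+ classical) · (x ^ (+ k whole) · y ^ (+ v) · z ^ (+ suc v))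

    M : ℤ → ℤ → ℤ → Carrier → Set _
    M = Monomial √x √y B

    A≈ : val A ≈ val √x · inv √y · val B
    A≈ = begin
      val A                     ≈⟨ *-identityʳ _ ⟨
      val A · 1#                ≈⟨ *-congˡ (Unit.val*inv (B ⁻¹)) ⟨
      val A · (inv B · val B)   ≈⟨ *-assoc _ _ _ ⟨
      val A · inv B · val B     ≈⟨ *-congʳ √x/√y≈A/B ⟨
      val √x · inv √y · val B   ∎

    A^ : ∀ i → M i (ℤ.- i) i (A ^ i)
    A^ i = is-monomial (begin
      A ^ i                              ≈⟨ ^-cong A (√x ⊗ √y ⁻¹ ⊗ B) A≈ i ⟩
      (√x ⊗ √y ⁻¹ ⊗ B) ^ i               ≈⟨ ^-⊗ (√x ⊗ √y ⁻¹) B i ⟩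
      (√x ⊗ √y ⁻¹) ^ i · B ^ i           ≈⟨ *-congʳ (^-⊗ √x (√y ⁻¹) i) ⟩
      √x ^ i · (√y ⁻¹) ^ i · B ^ i       ≈⟨ *-congʳ (*-congˡ (^-⁻¹ √y i)) ⟩
      √x ^ i · √y ^ (ℤ.- i) · B ^ i      ∎)

    B^ : ∀ i → M (+ 0) (+ 0) i (B ^ i)
    B^ i = is-monomial (≈-sym (≈-trans (*-congʳ (*-identityˡ 1#)) (*-identityˡ _)))

    √x^ : ∀ i → M i (+ 0) (+ 0) (√x ^ i)
    √x^ i = is-monomial (≈-sym (≈-trans (*-identityʳ _) (*-identityʳ _)))

    √y^ : ∀ i → M (+ 0) i (+ 0) (√y ^ i)
    √y^ i = is-monomial (≈-sym (≈-trans (*-identityʳ _) (*-identityˡ _)))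

    -- The factor `1#` is what `B ^ (+ 0)` computes to, so the chain fits both `d^` and `z^`.
    d^≈ : ∀ i → d ^ i ≈ √x ^ i · √y ^ i · 1#
    d^≈ i = begin
      d ^ i                    ≈⟨ ^-cong d (√x ⊗ √y) (≈-sym √x√y≈d) i ⟩
      (√x ⊗ √y) ^ i            ≈⟨ ^-⊗ √x √y i ⟩
      √x ^ i · √y ^ i          ≈⟨ *-identityʳ _ ⟨
      √x ^ i · √y ^ i · 1#     ∎

    d^ : ∀ i → M i i (+ 0) (d ^ i)
    d^ i = is-monomial (d^≈ i)

    z^ : ∀ i → M (ℤ.- i) (ℤ.- i) (+ 0) (z ^ i)
    z^ i = is-monomial (≈-trans (^-cong z (d ⁻¹) z≈ i) (≈-trans (^-⁻¹ d i) (d^≈ (ℤ.- i))))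

    square^ : ∀ u √u → val √u · val √u ≈ val u → ∀ i → u ^ i ≈ √u ^ (i ℤ.+ i)
    square^ u √u √u²≈u i = begin
      u ^ i                ≈⟨ ^-cong u (√u ⊗ √u) (≈-sym √u²≈u) i ⟩
      (√u ⊗ √u) ^ i        ≈⟨ ^-⊗ √u √u i ⟩
      √u ^ i · √u ^ i      ≈⟨ ^-+ √u i i ⟨
      √u ^ (i ℤ.+ i)       ∎

    x^ : ∀ i → M (i ℤ.+ i) (+ 0) (+ 0) (x ^ i)
    x^ i = is-monomial (≈-trans (square^ x √x √x²≈x i) (≈-monomial (√x^ (i ℤ.+ i))))

    y^ : ∀ i → M (+ 0) (i ℤ.+ i) (+ 0) (y ^ i)
    y^ i = is-monomial (≈-trans (square^ y √y √y²≈y i) (≈-monomial (√y^ (i ℤ.+ i))))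

    -- Stated for arbitrary integers, with genuine differences in place of `⊖` and `c ℤ.- b` in
    -- place of 2s(F), so that the exponents match by ring identities alone.
    monomials≈ : ∀ a b D V κ κF c →
      A ^ a · B ^ b · d ^ (D ℤ.- + 1) ≈
      A ^ (a ℤ.+ b) · (x ^ κ · y ^ V · z ^ (+ 1 ℤ.+ V)) ·
        (√x ^ (+ 2 ℤ.* ((V ℤ.- κ) ℤ.- (V ℤ.- κF)) ℤ.+ (c ℤ.- b))
          · √y ^ (+ 2 ℤ.* (c ℤ.- (V ℤ.- κF)) ℤ.- (c ℤ.- b))
          · z ^ ((κF ℤ.- D) ℤ.+ (c ℤ.- (V ℤ.- κF))))
    monomials≈ a b D V κ κF c = monomial-≈
      (A^ a ⊛ B^ b ⊛ d^ (D ℤ.- + 1))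
      (A^ (a ℤ.+ b) ⊛ (x^ κ ⊛ y^ V ⊛ z^ (+ 1 ℤ.+ V)) ⊛
        (√x^ (+ 2 ℤ.* ((V ℤ.- κ) ℤ.- (V ℤ.- κF)) ℤ.+ (c ℤ.- b))
          ⊛ √y^ (+ 2 ℤ.* (c ℤ.- (V ℤ.- κF)) ℤ.- (c ℤ.- b))
          ⊛ z^ ((κF ℤ.- D) ℤ.+ (c ℤ.- (V ℤ.- κF)))))
      (x-exponent a b D V κ κF c) (y-exponent a b D V κF c) (B-exponent a b)

    term≈ : ∀ F → kauffmanTerm (resplit s F) ≈ prefactor · ribbonTerm F
    term≈ F = begin
      kauffmanTerm s′
        ≈⟨ monomials≈ (+ α L s′) (+ β L s′) (+ δ L s′) (+ v) (+ k whole) (+ k F) (+ e F) ⟩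
      A ^ (+ α L s′ ℤ.+ + β L s′) · (x ^ (+ k whole) · y ^ (+ v) · z ^ (+ suc v))
        · (√x ^ (+ 2 ℤ.* (rank whole ℤ.- rank F) ℤ.+ twiceS)
            · √y ^ (+ 2 ℤ.* nullity ℤ.- twiceS) · z ^ (+ k F ℤ.- + δ L s′ ℤ.+ nullity))
        -- Returns to the invariants of the graph: α(s′) + β(s′) is the number of classical
        -- crossings, `twiceS` is 2s(F), δ(s′) is f(F), and differences of naturals become `⊖`.
        ≈⟨ ≈-reflexive (cong₂ _·_
             (cong (λ m → A ^ (+ m) · (x ^ (+ k whole) · y ^ (+ v) · z ^ (+ suc v))) (α+β≡m s′))
             (cong₂ _·_
               (cong₂ _·_
                 (cong (√x ^_) (cong₂ (λ i j → + 2 ℤ.* i ℤ.+ j)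
                   (cong₂ ℤ._-_ (ℤₚ.m-n≡m⊖n v (k whole)) (ℤₚ.m-n≡m⊖n v (k F))) twiceS≡2s))
                 (cong (√y ^_) (cong₂ (λ i j → + 2 ℤ.* i ℤ.- j) nullity≡n twiceS≡2s)))
               (cong (z ^_) (cong₂ ℤ._+_
                 (≡.trans (cong (λ b → + k F ℤ.- + b) (≡.sym (f≡δ L s F))) (ℤₚ.m-n≡m⊖n (k F) (f F)))
                 nullity≡n)))) ⟩
      prefactor · ribbonTerm F
        ∎
      where
      s′ : State L
      s′ = resplit s F

      rank : Spanning → ℤ
      rank F = + v ℤ.- + k F

      nullity twiceS : ℤ
      nullity = + e F ℤ.- rank F
      twiceS  = + e F ℤ.- + β L s′

      twiceS≡2s : twiceS ≡ 2s F
      twiceS≡2s = ≡.sym (⊖-balance (β L s′) (e₋ F) (e F) (e₋ (∁ F)) (β-resplit s F))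

      nullity≡n : nullity ≡ n F
      nullity≡n = cong (λ i → + e F ℤ.- i) (ℤₚ.m-n≡m⊖n v (k F))

    kauffman≈bollobásRiordan : kauffman L A B d ≈
      A ^ (+ classical) ·
        (x ^ (+ k whole) · y ^ (+ v) · z ^ (+ suc v) · bollobásRiordan G √x √y z)
    kauffman≈bollobásRiordan = begin
      kauffman L A B d                                        ≈⟨ sum-resplit s kauffmanTerm ⟩
      sum (map (λ F → kauffmanTerm (resplit s F)) (𝓕 G))      ≈⟨ sum-cong term≈ (𝓕 G) ⟩
      sum (map (λ F → prefactor · ribbonTerm F) (𝓕 G))        ≈⟨ *-sum prefactor ribbonTerm (𝓕 G) ⟨
      prefactor · bollobásRiordan G √x √y z                   ≈⟨ *-assoc _ _ _ ⟩
      A ^ (+ classical) ·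
        (x ^ (+ k whole) · y ^ (+ v) · z ^ (+ suc v) · bollobásRiordan G √x √y z) ∎

theorem6p3 : ∀ {a ℓ} (K : CommutativeRing a ℓ) (L : VirtualLinkDiagram) (s : State L) →
    let open CommutativeRing K using (_≈_) renaming (_*_ to _·_)
        open Evaluation K
        open VirtualLinkDiagram L using (classical)
        G = stateRibbonGraph L s
        open SignedRibbonGraph G
    in
    (classical ≡ e whole) ×
    ((A B d x y z √x √y : Unit) →
      val x ≈ val A · val d · inv B →
      val y ≈ val B · val d · inv A →
      val z ≈ inv d →
      val √x · val √x ≈ val x →
      val √y · val √y ≈ val y →
      val √x · val √y ≈ val d →
      val √x · inv √y ≈ val A · inv B →
      kauffman L A B d ≈
        A ^ (+ classical) ·
          (x ^ (+ k whole) · y ^ (+ v) · z ^ (+ suc v) · bollobásRiordan G √x √y z))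
-- Edges are labelled by the classical crossings, so the first claim is the size of the full subset.
theorem6p3 K L s = ≡.sym (∣⊤∣≡n (VirtualLinkDiagram.classical L)) ,
  λ A B d x y z √x √y _ _ → kauffman≈bollobásRiordan K L s A B d x y z √x √y
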